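{- There exist finite and nonempty sets $S\subset\mathbb{N}\setminus\{1\}$ such that $\mathrm{MIN}(S)<\mathrm{FIB}(S)$ and $\operatorname{lcm}(S)$ has two distinct prime factors.
   Context: $\mathbb{N}=\{1,2,\dots\}$, $\mathbb{N}_0=\mathbb{N}\cup\{0\}$. For a finite nonempty set $A\subset\mathbb{N}_0$, its mask polynomial is $A(X)=\sum_{a\in A}X^a$. $\Phi_s(X)$ denotes the $s$-th cyclotomic polynomial. $\operatorname{lcm}(S)$ is the least common multiple of the elements of $S$; "two distinct prime factors" means exactly two. For a finite nonempty $S\subset\mathbb{N}\setminus\{1\}$, $\mathrm{MIN}(S)$ is the minimum of $|A|$ over all finite nonempty sets $A\subset\mathbb{N}_0$ such that $\Phi_s(X)\mid A(X)$ for all $s\in S$. For $N\in\mathbb{N}$ and a prime $p\mid N$, let $F^N_p(X)=\Phi_p(X^{N/p})=1+X^{N/p}+\dots+X^{(p-1)N/p}$. A finite nonempty set $A\subset\mathbb{N}_0$ is fibered on scale $N$ if there is a prime $p\mid N$ such that $F^N_p(X)\mid A(X)$. $\mathrm{FIB}(S)$ is the smallest size of a finite nonempty set $A\subset\mathbb{N}_0$ that is fibered on each scale $s\in S$ (the prime $p$ may depend on $s$). -}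

module Defs where

open import Data.Bool.Base using (if_then_else_)
open import Data.Integer.Base as ℤ using (ℤ; 0ℤ; 1ℤ; -1ℤ)
import Data.Integer.Properties as ℤ
open import Data.List.Base using (List; []; _∷_; map; foldr; filter; length; replicate; upTo; _++_)
open import Data.List.Membership.Propositional using (_∈_)
open import Data.List.Properties using (map-cong-local)
open import Data.List.Relation.Unary.All as All using (All)
open import Data.List.Relation.Unary.All.Properties using (all-upTo; map⁺; filter⁺)
open import Data.List.Relation.Unary.Unique.Propositional using (Unique)
open import Data.Nat.Base using (ℕ; zero; suc; pred; _*_; _/_; _≤_; NonZero; z≤n; s≤s)
open import Data.Nat.Divisibility using (_∣_; _∣?_)
import Data.Nat.LCM as LCM
open import Data.Nat.Primality using (Prime; prime⇒nonZero)
open import Data.Nat.Properties using (≤-trans; ≤-refl; pred-mono-≤)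
open import Data.Product.Base using (Σ; ∃-syntax; _×_; _,_; proj₁)
open import Data.Sum.Base using (_⊎_)
open import Relation.Binary.PropositionalEquality using (_≡_; _≢_; refl; cong)
open import Relation.Nullary.Decidable using (does)

------------------------------------------------------------------------
-- Polynomials over ℤ

-- Coefficient lists, constant term first. Trailing zeros are allowed, so
-- polynomials are compared by _≈_ rather than by _≡_.
Poly : Set
Poly = List ℤ

coeff : Poly → ℕ → ℤ
coeff []      _       = 0ℤ
coeff (a ∷ f) zero    = a
coeff (a ∷ f) (suc n) = coeff f n

infix 4 _≈_ _∣ᴾ_

_≈_ : Poly → Poly → Set
f ≈ g = ∀ n → coeff f n ≡ coeff g n

infixl 6 _+ᴾ_
infixl 7 _·_ _*ᴾ_ _/ᴾ_

_+ᴾ_ : Poly → Poly → Poly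
[]      +ᴾ g       = g
(a ∷ f) +ᴾ []      = a ∷ f
(a ∷ f) +ᴾ (b ∷ g) = (a ℤ.+ b) ∷ (f +ᴾ g)

_·_ : ℤ → Poly → Poly
c · f = map (c ℤ.*_) f

_*ᴾ_ : Poly → Poly → Poly
[]      *ᴾ g = []
(a ∷ f) *ᴾ g = (a · g) +ᴾ (0ℤ ∷ (f *ᴾ g))

X^_ : ℕ → Poly
X^ n = replicate n 0ℤ ++ (1ℤ ∷ [])

sumᴾ : List Poly → Poly
sumᴾ = foldr _+ᴾ_ []

productᴾ : List Poly → Poly
productᴾ = foldr _*ᴾ_ (1ℤ ∷ [])

_∣ᴾ_ : Poly → Poly → Set
f ∣ᴾ g = ∃[ q ] f *ᴾ q ≈ g

trim : Poly → Poly
trim []      = []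
trim (a ∷ f) with trim f
... | []    = if does (a ℤ.≟ 0ℤ) then [] else (a ∷ [])
... | b ∷ g = a ∷ b ∷ g

-- The degree, with value 0 on the zero polynomial.
degree : Poly → ℕ
degree f = pred (length (trim f))

-- Division with remainder by a monic polynomial g of degree d: if
-- f = q g + r with deg r < d, then a + X f = (c + X q) g + (a + X r - c g),
-- where c is the coefficient of X^d in a + X r.
quotRem : (d : ℕ) (g : Poly) → Poly → Poly × Poly
quotRem d g []      = [] , []
quotRem d g (a ∷ f) = step (quotRem d g f)
  where
  reduce : Poly → ℤ → Poly → Poly × Poly
  reduce q c r = c ∷ q , r +ᴾ ((ℤ.- c) · g)

  step : Poly × Poly → Poly × Poly
  step (q , r) = reduce q (coeff (a ∷ r) d) (a ∷ r)

-- The quotient; meaningful only when the divisor is monic.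
_/ᴾ_ : Poly → Poly → Poly
f /ᴾ g = proj₁ (quotRem (degree g) g f)

------------------------------------------------------------------------
-- Cyclotomic polynomials

properDivisors : ℕ → List ℕ
properDivisors n = filter (_∣? n) (map suc (upTo (pred n)))

X^n-1 : ℕ → Poly
X^n-1 n = (X^ n) +ᴾ (-1ℤ ∷ [])

-- The first argument bounds the recursion depth; any bound ≥ n gives the
-- same value at n ≥ 1, see Φ-fuel-irrelevant.
Φ-fuel : ℕ → ℕ → Poly
Φ-fuel zero    n = []
Φ-fuel (suc k) n = X^n-1 n /ᴾ productᴾ (map (Φ-fuel k) (properDivisors n))

-- Determined by X^n - 1 = ∏_{d ∣ n} Φ d, solved for Φ n; see Φ-unfold.
-- The value at 0 is junk.
Φ : ℕ → Poly
Φ n = Φ-fuel n n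

properDivisors-bounds : ∀ n → All (λ d → 1 ≤ d × d ≤ pred n) (properDivisors n)
properDivisors-bounds n =
  filter⁺ (_∣? n) (map⁺ (All.map (λ d<n → s≤s z≤n , d<n) (all-upTo (pred n))))

Φ-fuel-irrelevant : ∀ j k n → 1 ≤ n → n ≤ j → n ≤ k → Φ-fuel j n ≡ Φ-fuel k n
Φ-fuel-irrelevant (suc j) (suc k) n (s≤s _) n≤j n≤k =
  cong (λ fs → X^n-1 n /ᴾ productᴾ fs)
    (map-cong-local
      (All.map
        (λ {d} (1≤d , d<n) → Φ-fuel-irrelevant j k d 1≤d
          (≤-trans d<n (pred-mono-≤ n≤j)) (≤-trans d<n (pred-mono-≤ n≤k)))
        (properDivisors-bounds n)))

Φ-unfold : ∀ n → 1 ≤ n →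
           Φ n ≡ X^n-1 n /ᴾ productᴾ (map Φ (properDivisors n))
Φ-unfold n@(suc m) 1≤n =
  cong (λ fs → X^n-1 n /ᴾ productᴾ fs)
    (map-cong-local
      (All.map
        (λ {d} (1≤d , d≤m) → Φ-fuel-irrelevant m d d 1≤d d≤m ≤-refl)
        (properDivisors-bounds n)))

-- Φ₁₂ = X⁴ - X² + 1
_ : trim (Φ 12) ≡ 1ℤ ∷ 0ℤ ∷ -1ℤ ∷ 0ℤ ∷ 1ℤ ∷ []
_ = refl

-- Φ₁₈ = X⁶ - X³ + 1
_ : trim (Φ 18) ≡ 1ℤ ∷ 0ℤ ∷ 0ℤ ∷ -1ℤ ∷ 0ℤ ∷ 0ℤ ∷ 1ℤ ∷ []
_ = refl

------------------------------------------------------------------------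
-- Finite sets of natural numbers

record FinSet : Set where
  constructor finSet
  field
    elements : List ℕ
    unique   : Unique elements

open FinSet public

card : FinSet → ℕ
card A = length (elements A)

infix 4 _∈ˢ_

_∈ˢ_ : ℕ → FinSet → Set
n ∈ˢ A = n ∈ elements A

Nonempty : FinSet → Set
Nonempty A = ∃[ n ] n ∈ˢ A

mask : FinSet → Poly
mask A = sumᴾ (map X^_ (elements A))

lcm : FinSet → ℕ
lcm S = foldr LCM.lcm 1 (elements S)

------------------------------------------------------------------------
-- MIN and FIB

F : (N p : ℕ) .{{_ : NonZero p}} → Poly
F N p = sumᴾ (map (λ k → X^ (k * (N / p))) (upTo p))

FiberedOn : FinSet → ℕ → Set
FiberedOn A N =
  ∃[ p ] Σ (Prime p) λ pr → p ∣ N × (F N p {{prime⇒nonZero pr}} ∣ᴾ mask A)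

IsMinimumSize : (FinSet → Set) → ℕ → Set
IsMinimumSize P m =
  (∃[ A ] Nonempty A × P A × card A ≡ m) ×
  (∀ A → Nonempty A → P A → m ≤ card A)

-- The minima are given by their graphs: MIN S ≔ m says MIN(S) = m, and
-- FIB S ≔ n says FIB(S) = n.
MIN_≔_ : FinSet → ℕ → Set
MIN S ≔ m = IsMinimumSize (λ A → ∀ s → s ∈ˢ S → Φ s ∣ᴾ mask A) m

FIB_≔_ : FinSet → ℕ → Set
FIB S ≔ n = IsMinimumSize (λ A → ∀ s → s ∈ˢ S → FiberedOn A s) n

HasExactlyTwoPrimeFactors : ℕ → Set
HasExactlyTwoPrimeFactors n =
  ∃[ p ] ∃[ q ] Prime p × Prime q × p ≢ q × p ∣ n × q ∣ n ×
    (∀ r → Prime r → r ∣ n → r ≡ p ⊎ r ≡ q)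

{-# OPTIONS --safe #-}
-- The example is S = {4, 8, 16, 9, 27, 6}, with MIN(S) = 72 and FIB(S) = 144.
--
-- Divisibility by Φ₄, Φ₈, Φ₁₆ forces 8 ∣ |A|, and divisibility by Φ₉, Φ₂₇
-- forces 9 ∣ |A|, so MIN(S) ≥ 72. Being fibered on scale 6 in the direction 2
-- (resp. 3) doubles (resp. triples) this divisor, so FIB(S) ≥ 144, which
-- {3k : k < 144} attains.
--
-- A set of size 72 satisfies Φ₆ without being fibered on scale 6 if, modulo 6,
-- it is a sum of translates of both {0, 3} and {0, 2, 4}. We take 24 of the
-- former and 8 of the latter: three progressions of even length with step 3 and
-- one of length 24 with step 2. Their starting points are chosen such that the
-- union is also equidistributed as Φ₄, Φ₈, Φ₁₆, Φ₉, Φ₂₇ require.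
module Submission where

open import Defs
open import Data.Bool.Base using (true; false; if_then_else_)
open import Data.Integer.Base as ℤ using (ℤ; +_; 0ℤ; 1ℤ)
import Data.Integer.Divisibility.Signed as ℤ
import Data.Integer.Properties as ℤ
open import Data.Integer.Tactic.RingSolver using (solve-∀)
open import Data.List.Base using (List; []; _∷_; _++_; foldr; length; map; upTo)
open import Data.List.Properties using (≡-dec)
open import Data.List.Relation.Unary.All as All using ([]; _∷_)
open import Data.List.Relation.Unary.Any using (here)
open import Data.Nat.Base using (ℕ; zero; suc; _+_; _*_; _^_; _/_; _%_; _≤_; _<_; _<ᵇ_;
  z≤n; s≤s; NonZero; nonTrivial⇒≢1)
open import Data.Nat.Divisibility using (_∣_; divides; ∣⇒≤; ∣1⇒≡1)
open import Data.Nat.DivMod using (m%n<n; m%n%n≡m%n; %-distribˡ-+)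
open import Data.Nat.LCM using (lcm-least)
open import Data.Nat.Primality using (Prime; prime?; prime[2]; prime⇒nonZero;
  prime⇒irreducible; prime⇒nonTrivial; euclidsLemma)
open import Data.Nat.Properties using (_≟_; allUpTo?; m≤m+n; ≤-trans)
open import Data.List.Membership.DecPropositional _≟_ using (_∈?_)
open import Data.List.Relation.Unary.Unique.DecPropositional _≟_ using (unique?)
open import Data.Product.Base using (∃-syntax; _×_; _,_)
open import Data.Sum.Base as Sum using (_⊎_; inj₁; inj₂)
open import Function.Base using (_∘_; const)
open import Relation.Binary.PropositionalEquality
open import Relation.Nullary.Decidable using (True; toWitness; from-yes; yes; no)
open import Relation.Nullary.Negation using (contradiction)

open ≡-Reasoning

private variable
  φ ψ : ℕ → ℤ

-- Deciding equality and divisibility of polynomials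

trim-≈ : ∀ f → trim f ≈ f
trim-≈ []      n = refl
trim-≈ (a ∷ f) n with trim f | trim-≈ f
trim-≈ (a ∷ f) zero    | b ∷ g | ih = refl
trim-≈ (a ∷ f) (suc n) | b ∷ g | ih = ih n
trim-≈ (a ∷ f) n       | []    | ih with a ℤ.≟ 0ℤ
trim-≈ (a ∷ f) zero    | []    | ih | yes a≡0 = sym a≡0
trim-≈ (a ∷ f) (suc n) | []    | ih | yes a≡0 = ih n
trim-≈ (a ∷ f) zero    | []    | ih | no  _   = refl
trim-≈ (a ∷ f) (suc n) | []    | ih | no  _   = ih n

SameTrim : Poly → Poly → Set
SameTrim f g = True (≡-dec ℤ._≟_ (trim f) (trim g))

sameTrim⇒≈ : ∀ f g → SameTrim f g → f ≈ g
sameTrim⇒≈ f g eq n = begin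
  coeff f n         ≡⟨ trim-≈ f n ⟨
  coeff (trim f) n  ≡⟨ cong (λ h → coeff h n) (toWitness eq) ⟩
  coeff (trim g) n  ≡⟨ trim-≈ g n ⟩
  coeff g n         ∎

-- The quotient serves as a certificate: it is multiplied back and the product compared with `f` by
-- evaluation.
quotient⇒∣ᴾ : ∀ g f {_ : SameTrim (g *ᴾ (f /ᴾ g)) f} → g ∣ᴾ f
quotient⇒∣ᴾ g f {eq} = f /ᴾ g , sameTrim⇒≈ (g *ᴾ (f /ᴾ g)) f eq

-- Linear functionals on polynomials

-- The functional sending X^n to `φ n`. On a mask polynomial it sums `φ` over the set; `const 1ℤ`
-- gives evaluation at 1, hence the cardinality.
weight : (ℕ → ℤ) → Poly → ℤ
weight φ []      = 0ℤ
weight φ (a ∷ f) = a ℤ.* φ 0 ℤ.+ weight (φ ∘ suc) f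

weight-≈0 : ∀ φ f → [] ≈ f → weight φ f ≡ 0ℤ
weight-≈0 φ []      eq = refl
weight-≈0 φ (a ∷ f) eq = cong₂ (λ b w → b ℤ.* φ 0 ℤ.+ w)
  (sym (eq 0)) (weight-≈0 (φ ∘ suc) f (eq ∘ suc))

weight-≈ : ∀ φ f g → f ≈ g → weight φ f ≡ weight φ g
weight-≈ φ []      g       eq = sym (weight-≈0 φ g eq)
weight-≈ φ (a ∷ f) []      eq = weight-≈0 φ (a ∷ f) (sym ∘ eq)
weight-≈ φ (a ∷ f) (b ∷ g) eq = cong₂ (λ c w → c ℤ.* φ 0 ℤ.+ w)
  (eq 0) (weight-≈ (φ ∘ suc) f g (eq ∘ suc))

weight-cong : (∀ n → φ n ≡ ψ n) → ∀ f → weight φ f ≡ weight ψ f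
weight-cong eq []      = refl
weight-cong eq (a ∷ f) = cong₂ (λ v w → a ℤ.* v ℤ.+ w) (eq 0) (weight-cong (eq ∘ suc) f)

weight-linear : ∀ a φ ψ f →
  weight (λ n → a ℤ.* φ n ℤ.+ ψ n) f ≡ a ℤ.* weight φ f ℤ.+ weight ψ f
weight-linear a φ ψ []      = sym (trans (ℤ.+-identityʳ _) (ℤ.*-zeroʳ a))
weight-linear a φ ψ (b ∷ f) =
  trans (cong (λ w → b ℤ.* (a ℤ.* φ 0 ℤ.+ ψ 0) ℤ.+ w) (weight-linear a (φ ∘ suc) (ψ ∘ suc) f))
        (lemma b a (φ 0) (ψ 0) (weight (φ ∘ suc) f) (weight (ψ ∘ suc) f))
  where
  lemma : ∀ b a x y u v → b ℤ.* (a ℤ.* x ℤ.+ y) ℤ.+ (a ℤ.* u ℤ.+ v)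
                        ≡ a ℤ.* (b ℤ.* x ℤ.+ u) ℤ.+ (b ℤ.* y ℤ.+ v)
  lemma = solve-∀

weight-zero : ∀ f → weight (const 0ℤ) f ≡ 0ℤ
weight-zero []      = refl
weight-zero (a ∷ f) = cong₂ ℤ._+_ (ℤ.*-zeroʳ a) (weight-zero f)

weight-+ᴾ : ∀ φ f g → weight φ (f +ᴾ g) ≡ weight φ f ℤ.+ weight φ g
weight-+ᴾ φ []      g       = sym (ℤ.+-identityˡ _)
weight-+ᴾ φ (a ∷ f) []      = sym (ℤ.+-identityʳ _)
weight-+ᴾ φ (a ∷ f) (b ∷ g) =
  trans (cong (λ w → (a ℤ.+ b) ℤ.* φ 0 ℤ.+ w) (weight-+ᴾ (φ ∘ suc) f g))
        (lemma a b (φ 0) (weight (φ ∘ suc) f) (weight (φ ∘ suc) g))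
  where
  lemma : ∀ a b x u v → (a ℤ.+ b) ℤ.* x ℤ.+ (u ℤ.+ v)
                      ≡ (a ℤ.* x ℤ.+ u) ℤ.+ (b ℤ.* x ℤ.+ v)
  lemma = solve-∀

weight-· : ∀ φ a f → weight φ (a · f) ≡ a ℤ.* weight φ f
weight-· φ a []      = sym (ℤ.*-zeroʳ a)
weight-· φ a (b ∷ f) =
  trans (cong (λ w → a ℤ.* b ℤ.* φ 0 ℤ.+ w) (weight-· (φ ∘ suc) a f))
        (lemma a b (φ 0) (weight (φ ∘ suc) f))
  where
  lemma : ∀ a b x u → a ℤ.* b ℤ.* x ℤ.+ a ℤ.* u ≡ a ℤ.* (b ℤ.* x ℤ.+ u)
  lemma = solve-∀

weight-X^ : ∀ φ n → weight φ (X^ n) ≡ φ n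
weight-X^ φ zero    = trans (ℤ.+-identityʳ _) (ℤ.*-identityˡ _)
weight-X^ φ (suc n) = trans (ℤ.+-identityˡ _) (weight-X^ (φ ∘ suc) n)

-- By bilinearity this amounts to X^i X^j = X^(i+j). A known factor `f` thus replaces `φ` by a
-- combination of its shifts.
weight-*ᴾ : ∀ φ f g → weight φ (f *ᴾ g) ≡ weight (λ j → weight (λ i → φ (i + j)) f) g
weight-*ᴾ φ []      g = sym (weight-zero g)
weight-*ᴾ φ (a ∷ f) g = begin
  weight φ ((a · g) +ᴾ (0ℤ ∷ (f *ᴾ g)))
    ≡⟨ weight-+ᴾ φ (a · g) _ ⟩
  weight φ (a · g) ℤ.+ (0ℤ ℤ.+ weight (φ ∘ suc) (f *ᴾ g))
    ≡⟨ cong₂ ℤ._+_ (weight-· φ a g)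
         (trans (ℤ.+-identityˡ _) (weight-*ᴾ (φ ∘ suc) f g)) ⟩
  a ℤ.* weight φ g ℤ.+ weight (λ j → weight (λ i → φ (suc (i + j))) f) g
    ≡⟨ weight-linear a φ _ g ⟨
  weight (λ j → a ℤ.* φ j ℤ.+ weight (λ i → φ (suc (i + j))) f) g
    ∎

δ : ℕ → ℕ → ℤ
δ zero    zero    = 1ℤ
δ zero    (suc i) = 0ℤ
δ (suc n) zero    = 0ℤ
δ (suc n) (suc i) = δ n i

weight-δ : ∀ n f → weight (δ n) f ≡ coeff f n
weight-δ n       []      = refl
weight-δ zero    (a ∷ f) =
  trans (cong₂ ℤ._+_ (ℤ.*-identityʳ a) (weight-zero f)) (ℤ.+-identityʳ a)
weight-δ (suc n) (a ∷ f) =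
  trans (cong₂ ℤ._+_ (ℤ.*-zeroʳ a) (weight-δ n f)) (ℤ.+-identityˡ _)

-- Coefficients are weights against `δ n`, and by `weight-*ᴾ` such a weight on a product depends on
-- the first factor only through weights, which respect `_≈_`.
*ᴾ-congʳ : ∀ f g h → f ≈ g → f *ᴾ h ≈ g *ᴾ h
*ᴾ-congʳ f g h f≈g n = begin
  coeff (f *ᴾ h) n                                ≡⟨ weight-δ n (f *ᴾ h) ⟨
  weight (δ n) (f *ᴾ h)                           ≡⟨ weight-*ᴾ (δ n) f h ⟩
  weight (λ j → weight (λ i → δ n (i + j)) f) h   ≡⟨ weight-cong (λ j → weight-≈ _ f g f≈g) h ⟩
  weight (λ j → weight (λ i → δ n (i + j)) g) h   ≡⟨ weight-*ᴾ (δ n) g h ⟨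
  weight (δ n) (g *ᴾ h)                           ≡⟨ weight-δ n (g *ᴾ h) ⟩
  coeff (g *ᴾ h) n                                ∎

sumℤ : List ℤ → ℤ
sumℤ = foldr ℤ._+_ 0ℤ

weight-sumᴾ : ∀ φ (e : ℕ → ℕ) ks →
  weight φ (sumᴾ (map (λ k → X^ (e k)) ks)) ≡ sumℤ (map (φ ∘ e) ks)
weight-sumᴾ φ e []       = refl
weight-sumᴾ φ e (k ∷ ks) =
  trans (weight-+ᴾ φ (X^ (e k)) _) (cong₂ ℤ._+_ (weight-X^ φ (e k)) (weight-sumᴾ φ e ks))

weight-mask : ∀ A → weight (const 1ℤ) (mask A) ≡ + card A
weight-mask A = trans (weight-sumᴾ (const 1ℤ) (λ n → n) (elements A)) (sum-ones (elements A))
  where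
  sum-ones : ∀ ks → sumℤ (map (const 1ℤ) ks) ≡ + length ks
  sum-ones []       = refl
  sum-ones (k ∷ ks) = cong (λ s → 1ℤ ℤ.+ s) (sum-ones ks)

∣-weight : ∀ {d} → (∀ n → d ℤ.∣ φ n) → ∀ f → d ℤ.∣ weight φ f
∣-weight d∣φ []      = ℤ.divides 0ℤ refl
∣-weight d∣φ (a ∷ f) =
  ℤ.∣m∣n⇒∣m+n (ℤ.∣n⇒∣m*n a (d∣φ 0)) (∣-weight (d∣φ ∘ suc) f)

-- Equidistribution

fiberSum : (N p : ℕ) .{{_ : NonZero p}} → (ℕ → ℤ) → ℤ
fiberSum N p φ = sumℤ (map (λ k → φ (k * (N / p))) (upTo p))

sumℤ-map-cong : (∀ n → φ n ≡ ψ n) → ∀ ks → sumℤ (map φ ks) ≡ sumℤ (map ψ ks)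
sumℤ-map-cong eq []       = refl
sumℤ-map-cong eq (k ∷ ks) = cong₂ ℤ._+_ (eq k) (sumℤ-map-cong eq ks)

-- Since `f` is `F N p` times `q`, a weight on `f` sees a function only through its sums over the
-- fibers {j + k N/p : k < p}. Values may therefore be redistributed within fibers.
weight-fibered : ∀ N p .{{_ : NonZero p}} φ ψ f →
  (∀ j → fiberSum N p (λ i → φ (i + j)) ≡ fiberSum N p (λ i → ψ (i + j))) →
  F N p ∣ᴾ f → weight φ f ≡ weight ψ f
weight-fibered N p φ ψ f same (q , Fq≈f) =
  trans (expand φ) (trans (weight-cong same q) (sym (expand ψ)))
  where
  expand : ∀ χ → weight χ f ≡ weight (λ j → fiberSum N p (λ i → χ (i + j))) q
  expand χ = begin
    weight χ f                                     ≡⟨ weight-≈ χ (F N p *ᴾ q) f Fq≈f ⟨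
    weight χ (F N p *ᴾ q)                          ≡⟨ weight-*ᴾ χ (F N p) q ⟩
    weight (λ j → weight (λ i → χ (i + j)) (F N p)) q
      ≡⟨ weight-cong (λ j → weight-sumᴾ (λ i → χ (i + j)) (_* (N / p)) (upTo p)) q ⟩
    weight (λ j → fiberSum N p (λ i → χ (i + j))) q ∎

%-absorbʳ : ∀ M .{{_ : NonZero M}} i j → (i + j % M) % M ≡ (i + j) % M
%-absorbʳ M i j = begin
  (i + j % M) % M          ≡⟨ %-distribˡ-+ i (j % M) M ⟩
  (i % M + j % M % M) % M  ≡⟨ cong (λ r → (i % M + r) % M) (m%n%n≡m%n j M) ⟩
  (i % M + j % M) % M      ≡⟨ %-distribˡ-+ i j M ⟨
  (i + j) % M              ∎

periodic : (M : ℕ) .{{_ : NonZero M}} → (ℕ → ℤ) → ℕ → ℤ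
periodic M φ n = φ (n % M)

module _ (M N p : ℕ) .{{_ : NonZero M}} .{{_ : NonZero p}} (φ ψ : ℕ → ℤ) (f : Poly) where

  shiftedSum : (ℕ → ℤ) → ℕ → ℤ
  shiftedSum χ j = fiberSum N p (λ i → periodic M χ (i + j))

  -- Fiber sums of M-periodic functions are M-periodic in the shift j, so comparing them for j < M,
  -- by evaluation, suffices.
  weight-periodic :
    {_ : True (allUpTo? (λ j → shiftedSum φ j ℤ.≟ shiftedSum ψ j) M)} →
    F N p ∣ᴾ f → weight (periodic M φ) f ≡ weight (periodic M ψ) f
  weight-periodic {check} = weight-fibered N p (periodic M φ) (periodic M ψ) f λ j → begin
    shiftedSum φ j        ≡⟨ reduce φ j ⟨
    shiftedSum φ (j % M)  ≡⟨ toWitness check (m%n<n j M) ⟩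
    shiftedSum ψ (j % M)  ≡⟨ reduce ψ j ⟩
    shiftedSum ψ j        ∎
    where
    reduce : ∀ χ j → shiftedSum χ (j % M) ≡ shiftedSum χ j
    reduce χ j = sumℤ-map-cong
      (λ k → cong χ (%-absorbʳ M (k * (N / p)) j)) (upTo p)

-- Normalised to have mean 1 over its period c m, so that it can take the place of the constant 1.
window : (c m : ℕ) .{{_ : NonZero (c * m)}} → ℕ → ℤ
window c m n = if n % (c * m) <ᵇ m then + c else 0ℤ

∣-window : ∀ c m .{{_ : NonZero (c * m)}} n → + c ℤ.∣ window c m n
∣-window c m n with n % (c * m) <ᵇ m
... | true  = ℤ.∣-refl
... | false = ℤ.divides 0ℤ refl

-- The window takes only the values 0 and c, so its weight on the mask is a multiple of c; by
-- hypothesis this weight is |A|.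
window⇒∣card : ∀ M c m .{{_ : NonZero M}} .{{_ : NonZero (c * m)}} A →
  weight (const 1ℤ) (mask A) ≡ weight (periodic M (window c m)) (mask A) → c ∣ card A
window⇒∣card M c m A eq = ℤ.∣⇒∣ᵤ
  (subst (+ c ℤ.∣_) (trans (sym eq) (weight-mask A))
    (∣-weight (λ n → ∣-window c m (n % M)) (mask A)))

-- Each divisor F N p allows the window to become sparser by a factor p while
-- its height is multiplied by p.

module _ (A : FinSet) where

  8∣card : F 4 2 ∣ᴾ mask A → F 8 2 ∣ᴾ mask A → F 16 2 ∣ᴾ mask A → 8 ∣ card A
  8∣card d₄ d₈ d₁₆ = window⇒∣card 16 8 2 A
    -- The shifts by 2, 4 and 8 preserve parity, so the windows keep one residue of each parity: 0
    -- and 1.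
    (trans (weight-periodic 16 4  2 (const 1ℤ)   (window 2 2) (mask A) d₄)
    (trans (weight-periodic 16 8  2 (window 2 2) (window 4 2) (mask A) d₈)
           (weight-periodic 16 16 2 (window 4 2) (window 8 2) (mask A) d₁₆)))

  9∣card : F 9 3 ∣ᴾ mask A → F 27 3 ∣ᴾ mask A → 9 ∣ card A
  9∣card d₉ d₂₇ = window⇒∣card 27 9 3 A
    (trans (weight-periodic 27 9  3 (const 1ℤ)   (window 3 3) (mask A) d₉)
           (weight-periodic 27 27 3 (window 3 3) (window 9 3) (mask A) d₂₇))

  16∣card : F 6 2 ∣ᴾ mask A →
            F 4 2 ∣ᴾ mask A → F 8 2 ∣ᴾ mask A → F 16 2 ∣ᴾ mask A → 16 ∣ card A
  16∣card d₆ d₄ d₈ d₁₆ = window⇒∣card 16 16 1 A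
    -- Points at distance 6/2 = 3 have opposite parity, so all weight can first be moved to the even
    -- numbers.
    (trans (weight-periodic 16 6  2 (const 1ℤ)   (window 2 1)  (mask A) d₆)
    (trans (weight-periodic 16 4  2 (window 2 1) (window 4 1)  (mask A) d₄)
    (trans (weight-periodic 16 8  2 (window 4 1) (window 8 1)  (mask A) d₈)
           (weight-periodic 16 16 2 (window 8 1) (window 16 1) (mask A) d₁₆))))

  27∣card : F 6 3 ∣ᴾ mask A → F 9 3 ∣ᴾ mask A → F 27 3 ∣ᴾ mask A → 27 ∣ card A
  27∣card d₆ d₉ d₂₇ = window⇒∣card 27 27 1 A
    -- The shifts 0, 2, 4 are distinct modulo 3, so all weight can first be moved to the multiples
    -- of 3.
    (trans (weight-periodic 27 6  3 (const 1ℤ)   (window 3 1)  (mask A) d₆)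
    (trans (weight-periodic 27 9  3 (window 3 1) (window 9 1)  (mask A) d₉)
           (weight-periodic 27 27 3 (window 9 1) (window 27 1) (mask A) d₂₇)))

∣card⇒≤ : ∀ {d} A → Nonempty A → d ∣ card A → d ≤ card A
∣card⇒≤ (finSet (_ ∷ _) _) _ = ∣⇒≤

-- Prime factors

prime[3] : Prime 3
prime[3] = from-yes (prime? 3)

prime⇒≢1 : ∀ {p} → Prime p → p ≢ 1
prime⇒≢1 pp = nonTrivial⇒≢1 {{prime⇒nonTrivial pp}}

prime∣^ : ∀ {p r} → Prime p → Prime r → ∀ k → r ∣ p ^ k → r ≡ p
prime∣^ pp pr zero r∣1 = contradiction (∣1⇒≡1 r∣1) (prime⇒≢1 pr)
prime∣^ {p} pp pr (suc k) r∣p^ with euclidsLemma p (p ^ k) pr r∣p^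
... | inj₂ r∣p^ = prime∣^ pp pr k r∣p^
... | inj₁ r∣p with prime⇒irreducible pp r∣p
...   | inj₁ r≡1 = contradiction r≡1 (prime⇒≢1 pr)
...   | inj₂ r≡p = r≡p

prime∣2^*3^ : ∀ {r} → Prime r → ∀ i j → r ∣ 2 ^ i * 3 ^ j → r ≡ 2 ⊎ r ≡ 3
prime∣2^*3^ pr i j r∣ = Sum.map (prime∣^ prime[2] pr i) (prime∣^ prime[3] pr j)
  (euclidsLemma (2 ^ i) (3 ^ j) pr r∣)

-- On a prime power scale p is the only possible direction.
fibered-prime-power : ∀ {p} (pp : Prime p) k A → FiberedOn A (p ^ k) →
  F (p ^ k) p {{prime⇒nonZero pp}} ∣ᴾ mask A
fibered-prime-power pp k A (r , pr , r∣p^ , d) with prime∣^ pp pr k r∣p^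
... | refl = d

fibered-6 : ∀ A → FiberedOn A 6 → F 6 2 ∣ᴾ mask A ⊎ F 6 3 ∣ᴾ mask A
fibered-6 A (r , pr , r∣6 , d) with prime∣2^*3^ pr 1 1 r∣6
... | inj₁ refl = inj₁ d
... | inj₂ refl = inj₂ d

-- The example

S : FinSet
S = finSet scales (from-yes (unique? scales))
  where
  scales : List ℕ
  scales = 4 ∷ 8 ∷ 16 ∷ 9 ∷ 27 ∷ 6 ∷ []

∀∈S : ∀ (P : ℕ → Set) → P 4 → P 8 → P 16 → P 9 → P 27 → P 6 → ∀ s → s ∈ˢ S → P s
∀∈S P p₄ p₈ p₁₆ p₉ p₂₇ p₆ s = All.lookup {P = P} (p₄ ∷ p₈ ∷ p₁₆ ∷ p₉ ∷ p₂₇ ∷ p₆ ∷ [])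

∈S : ∀ s {_ : True (s ∈? elements S)} → s ∈ˢ S
∈S s {s∈S} = toWitness s∈S

progression : ℕ → ℕ → ℕ → List ℕ
progression a d n = map (λ k → a + k * d) (upTo n)

-- Modulo 16, the step 3 progressions from 48, 52, 50 follow one another cyclically, covering each
-- residue 3 times in all; 0, 2, ..., 46 covers each even residue 3 times. Modulo 27, 9 terms of
-- step 3 cover a class modulo 3 evenly. As 28 and 10 are 1 modulo 9, what remains is one point at
-- each start, and 48, 50, 52 extend 0, 2, ..., 46 to 27 terms of step 2, a full residue system.
minimal : FinSet
minimal = finSet points (from-yes (unique? points))
  where
  points : List ℕ
  points = progression 0 2 24 ++ progression 48 3 28 ++ progression 50 3 10 ++ progression 52 3 10

-- With Y = X^3 the mask is (Y^144 - 1)/(Y - 1). It is a multiple of (1 + Y)(1 + Y^2)(1 + Y^4)(1 +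
-- Y^8), where 1 + Y is `F 6 2` and 1 + X^m divides 1 + Y^m for m = 2, 4, 8, and of (Y^9 - 1)/(Y -
-- 1), the product of `F 9 3` and `F 27 3`.
minimal-fibered : FinSet
minimal-fibered = finSet points (from-yes (unique? points))
  where
  points : List ℕ
  points = progression 0 3 144

-- Applied to powers N of p, where the N-th cyclotomic polynomial is that of p at X^(N/p). This
-- makes the fiber argument available for `MIN`.
Φ∣⇒F∣ : ∀ N p .{{_ : NonZero p}} {_ : SameTrim (F N p) (Φ N)} A → Φ N ∣ᴾ mask A → F N p ∣ᴾ mask A
Φ∣⇒F∣ N p {eq} A (q , Φq≈A) = q , λ n →
  trans (*ᴾ-congʳ (F N p) (Φ N) q (sameTrim⇒≈ (F N p) (Φ N) eq) n) (Φq≈A n)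

MIN-S : MIN S ≔ 72
MIN-S = (minimal , (0 , here refl) , divisible , refl) , lower
  where
  Φ∣ : ∀ s {_ : SameTrim (Φ s *ᴾ (mask minimal /ᴾ Φ s)) (mask minimal)} → Φ s ∣ᴾ mask minimal
  Φ∣ s {eq} = quotient⇒∣ᴾ (Φ s) (mask minimal) {eq}

  divisible : ∀ s → s ∈ˢ S → Φ s ∣ᴾ mask minimal
  divisible = ∀∈S (λ s → Φ s ∣ᴾ mask minimal)
    (Φ∣ 4) (Φ∣ 8) (Φ∣ 16) (Φ∣ 9) (Φ∣ 27) (Φ∣ 6)

  lower : ∀ A → Nonempty A → (∀ s → s ∈ˢ S → Φ s ∣ᴾ mask A) → 72 ≤ card A
  lower A ne d = ∣card⇒≤ A ne (lcm-least {8} {9}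
    (8∣card A (Φ∣⇒F∣ 4 2 A (d 4 (∈S 4))) (Φ∣⇒F∣ 8 2 A (d 8 (∈S 8))) (Φ∣⇒F∣ 16 2 A (d 16 (∈S 16))))
    (9∣card A (Φ∣⇒F∣ 9 3 A (d 9 (∈S 9))) (Φ∣⇒F∣ 27 3 A (d 27 (∈S 27)))))

FIB-S : FIB S ≔ 144
FIB-S = (minimal-fibered , (0 , here refl) , fibered , refl) , lower
  where
  fiberedOn : ∀ N p .{{_ : NonZero p}}
    {_ : SameTrim (F N p *ᴾ (mask minimal-fibered /ᴾ F N p)) (mask minimal-fibered)} →
    Prime p → p ∣ N → FiberedOn minimal-fibered N
  fiberedOn N p {eq} pp p∣N =
    p , pp , p∣N , quotient⇒∣ᴾ (F N p) (mask minimal-fibered) {eq}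

  fibered : ∀ s → s ∈ˢ S → FiberedOn minimal-fibered s
  fibered = ∀∈S (FiberedOn minimal-fibered)
    (fiberedOn 4 2 prime[2] (divides 2 refl))
    (fiberedOn 8 2 prime[2] (divides 4 refl))
    (fiberedOn 16 2 prime[2] (divides 8 refl))
    (fiberedOn 9 3 prime[3] (divides 3 refl))
    (fiberedOn 27 3 prime[3] (divides 9 refl))
    (fiberedOn 6 2 prime[2] (divides 3 refl))

  lower : ∀ A → Nonempty A → (∀ s → s ∈ˢ S → FiberedOn A s) → 144 ≤ card A
  lower A ne fib = Sum.[ from-2 , from-3 ] (fibered-6 A (fib 6 (∈S 6)))
    where
    d₄  = fibered-prime-power prime[2] 2 A (fib 4 (∈S 4))
    d₈  = fibered-prime-power prime[2] 3 A (fib 8 (∈S 8))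
    d₁₆ = fibered-prime-power prime[2] 4 A (fib 16 (∈S 16))
    d₉  = fibered-prime-power prime[3] 2 A (fib 9 (∈S 9))
    d₂₇ = fibered-prime-power prime[3] 3 A (fib 27 (∈S 27))

    from-2 : F 6 2 ∣ᴾ mask A → 144 ≤ card A
    from-2 d₆ = ∣card⇒≤ A ne
      (lcm-least {16} {9} (16∣card A d₆ d₄ d₈ d₁₆) (9∣card A d₉ d₂₇))

    from-3 : F 6 3 ∣ᴾ mask A → 144 ≤ card A
    -- Here the bound is lcm(8, 27) = 216 = 144 + 72.
    from-3 d₆ = ≤-trans (m≤m+n 144 72) (∣card⇒≤ A ne
      (lcm-least {8} {27} (8∣card A d₄ d₈ d₁₆) (27∣card A d₆ d₉ d₂₇)))

theorem1p3 : ∃[ S ] Nonempty S × (∀ s → s ∈ˢ S → 1 < s) ×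
    (∃[ m ] ∃[ n ] MIN S ≔ m × FIB S ≔ n × m < n) ×
    HasExactlyTwoPrimeFactors (lcm S)
theorem1p3 =
  S , (4 , ∈S 4) ,
  ∀∈S (1 <_)
      (s≤s (s≤s z≤n)) (s≤s (s≤s z≤n)) (s≤s (s≤s z≤n))
      (s≤s (s≤s z≤n)) (s≤s (s≤s z≤n)) (s≤s (s≤s z≤n)) ,
  (72 , 144 , MIN-S , FIB-S , m≤m+n 73 71) ,
  -- `lcm S` evaluates to 432 = 2^4 · 3^3, with cofactors 216 of 2 and 144 of 3.
  2 , 3 , prime[2] , prime[3] , (λ ()) ,
  divides 216 refl , divides 144 refl , λ r pr → prime∣2^*3^ pr 4 3
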